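{- For all integers $n\ge 4$ and $k\ge 2$, $r_o(M_k,P_n)\le n+2k-4$. Moreover, if in addition $n\ge 3k-3$, then $r_o(M_k,P_n)=n+2k-4$.
   Context: An ordered graph is a graph with a linear ordering on its vertices; subgraphs inherit the ordering, and copies are taken via order-preserving isomorphisms. The ordered path $P_n$ has vertices $v_1<\dots<v_n$ and edges $v_iv_{i+1}$. The serial $k$-edge matching $M_k$ is the ordered graph with vertices $v_1<w_1<v_2<w_2<\dots<v_k<w_k$ and edges $v_1w_1,\dots,v_kw_k$. The online ordered Ramsey game for ordered graphs $G,H$ is played on vertex set $\mathbb N$ with its usual order: on each turn Builder draws a new edge between two vertices and Painter colors it red or blue; the game ends when there is a red copy of $G$ or a blue copy of $H$. Builder minimizes and Painter maximizes the number of turns; $r_o(G,H)$ is the number of turns under optimal play. -}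

module Defs where

open import Data.Nat using (ℕ; zero; suc; _+_; _*_; _<_)
open import Data.Fin using (Fin; toℕ)
open import Data.Product using (Σ; _×_; _,_)
open import Data.Sum using (_⊎_)
open import Data.List using (List; []; _∷_)
open import Data.List.Membership.Propositional using (_∈_; _∉_)
open import Relation.Binary.PropositionalEquality using (_≡_)
open import Relation.Nullary using (¬_)

-- An ordered graph on vertices 0 < 1 < ... < size-1 (the order of Fin).
-- Edge a b is only ever consulted with toℕ a < toℕ b.
record OrdGraph : Set₁ where
  field
    size : ℕ
    Edge : Fin size → Fin size → Set
open OrdGraph public

Path : ℕ → OrdGraph
Path n = record { size = n ; Edge = λ a b → toℕ b ≡ suc (toℕ a) }

-- Serial k-edge matching M_k: v_1<w_1<...<v_k<w_k, i.e. v_i = 2(i-1), w_i = 2(i-1)+1;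
-- edges v_i w_i are exactly the pairs (2m, 2m+1).
Matching : ℕ → OrdGraph
Matching k = record { size = 2 * k
                    ; Edge = λ a b → Σ ℕ (λ m → (toℕ a ≡ 2 * m) × (toℕ b ≡ suc (2 * m))) }

data Colour : Set where
  red blue : Colour

-- A coloured edge (i , j , c) on the board ℕ, stored with i < j.
ColEdge : Set
ColEdge = ℕ × ℕ × Colour

HasCopy : OrdGraph → Colour → List ColEdge → Set
HasCopy G c hist =
  Σ (Fin (size G) → ℕ) λ f →
    ((a b : Fin (size G)) → toℕ a < toℕ b → f a < f b) ×
    ((a b : Fin (size G)) → toℕ a < toℕ b → Edge G a b → (f a , f b , c) ∈ hist)

GameOver : OrdGraph → OrdGraph → List ColEdge → Set
GameOver G H hist = HasCopy G red hist ⊎ HasCopy H blue hist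

-- BuilderWins G H t hist : from position hist, Builder can force the game to end
-- (red G or blue H) within at most t further turns, whatever Painter does.
data BuilderWins (G H : OrdGraph) : ℕ → List ColEdge → Set where
  done : ∀ {t hist} → GameOver G H hist → BuilderWins G H t hist
  move : ∀ {t hist} (i j : ℕ) → i < j →
         (∀ c → (i , j , c) ∉ hist) →
         (∀ c → BuilderWins G H t ((i , j , c) ∷ hist)) →
         BuilderWins G H (suc t) hist

OnlineRamseyAtMost : OrdGraph → OrdGraph → ℕ → Set
OnlineRamseyAtMost G H r = BuilderWins G H r []

OnlineRamseyIs : OrdGraph → OrdGraph → ℕ → Set
OnlineRamseyIs G H r = BuilderWins G H r [] × (∀ t → t < r → ¬ BuilderWins G H t [])

{-# OPTIONS --safe #-}

-- Builder first extends a blue path to the right until an edge (B , y) is painted red, then extends it to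
-- the left from its first vertex p, always into a gap that contains no earlier vertex. A red edge (q , p)
-- there is serial with all earlier red ones, and Builder goes on in the gap to the right of p, at the cost
-- of dropping p from the path. So the first red edge wastes one move and each later one wastes two.
--
-- Painter paints red exactly those edges that would complete a blue P_n, as long as this does not complete
-- a red M_k. When she is stuck there are k serial pairs (u , v) such that some blue path A into u and some
-- blue path B out of v have N = n - 2 edges together, while no blue path has more than N edges. Then there
-- are at least N + k - 2 blue edges. Indeed, take A₀ and B₀ for the leftmost pair (u₀ , v₀): they have N + 2
-- vertices, in at most two components of the blue graph. Every other pair, with one exception at most,
-- contributes a further vertex to these components or an edge outside them, for no path leads from u to v,
-- and m vertices in at most two components force m - 2 edges. The edges so contributed are distinct because
-- two pairs sharing one would need too many blue edges; this is where n ≥ 3k - 3 enters.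
module Submission where

open import Defs
open import Data.Nat using (ℕ; zero; suc; _≤_; _<_; _+_; _*_; _∸_; z≤n; s≤s; s≤s⁻¹; _≟_; _≤?_)
open import Data.Nat.Properties hiding (_≟_; _≤?_)
open import Data.Nat.Tactic.RingSolver using (solve-∀)
open import Data.Fin as Fin using (Fin; toℕ; fromℕ<)
open import Data.Fin.Properties using (toℕ-fromℕ<; toℕ<n; toℕ-inject₁)
open import Data.Product using (Σ; ∃-syntax; Σ-syntax; _×_; _,_; proj₁; proj₂)
open import Data.Sum as Sum using (_⊎_; inj₁; inj₂; [_,_]′)
open import Data.Empty using (⊥; ⊥-elim)
open import Data.List using (List; []; _∷_; _++_; length; filter; tabulate)
open import Data.List.Properties using (length-++; length-++-sucʳ; length-tabulate; filter-accept)
open import Data.List.Membership.DecPropositional _≟_ using (_∈?_)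
open import Data.List.Membership.Propositional using (_∈_; _∉_; find; lose)
open import Data.List.Membership.Propositional.Properties
  using (∈-∃++; ∈-++⁺ˡ; ∈-++⁺ʳ; ∈-++⁻; ∈-filter⁻)
open import Data.List.Relation.Binary.Sublist.Propositional using (_⊆_; []; _∷_; _∷ʳ_)
open import Data.List.Relation.Binary.Sublist.Propositional.Properties using (All-resp-⊆)
open import Data.List.Relation.Unary.All as All using (All; []; _∷_)
import Data.List.Relation.Unary.All.Properties as All
open import Data.List.Relation.Unary.AllPairs using (AllPairs; []; _∷_)
import Data.List.Relation.Unary.AllPairs.Properties as AllPairs
open import Data.List.Relation.Unary.Any as Any using (Any; here; there; any?)
open import Data.List.Relation.Unary.Unique.Propositional using (Unique)
import Data.List.Relation.Unary.Unique.Propositional.Properties as Unique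
open import Function using (_∘_)
open import Relation.Binary.PropositionalEquality
open import Relation.Nullary using (¬_; Dec; yes; no; contradiction)
open import Relation.Nullary.Decidable.Core using (¬¬-excluded-middle)
open import Relation.Unary using (Decidable)

-- Counting in lists without repetition

Arc : Set
Arc = ℕ × ℕ

unique-length-≤ : ∀ {A : Set} {xs ys : List A} → Unique xs → All (_∈ ys) xs → length xs ≤ length ys
unique-length-≤ [] [] = z≤n
unique-length-≤ {ys = ys} (x∉xs ∷ xs!) (x∈ys ∷ xs⊆ys) with ∈-∃++ x∈ys
... | as , bs , refl = ≤-trans (s≤s (unique-length-≤ xs! (All.zipWith avoid (x∉xs , xs⊆ys))))
                               (≤-reflexive (sym (length-++-sucʳ as _ bs)))
  where
  avoid : ∀ {y} → (_ ≢ y) × (y ∈ as ++ _ ∷ bs) → y ∈ as ++ bs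
  avoid (x≢y , y∈) with ∈-++⁻ as y∈
  ... | inj₁ p           = ∈-++⁺ˡ p
  ... | inj₂ (here eq)   = contradiction (sym eq) x≢y
  ... | inj₂ (there p)   = ∈-++⁺ʳ as p

disjoint-length-≤ : ∀ {A : Set} {xs ys zs : List A} → Unique xs → Unique ys →
  (∀ {z} → z ∈ xs → z ∉ ys) → All (_∈ zs) xs → All (_∈ zs) ys → length xs + length ys ≤ length zs
disjoint-length-≤ {xs = xs} xs! ys! disj xs⊆ ys⊆ =
  subst (_≤ _) (length-++ xs)
    (unique-length-≤ (Unique.++⁺ xs! ys! (λ { (p , q) → disj p q })) (All.++⁺ xs⊆ ys⊆))

split : ∀ {A : Set} {P Q : A → Set} {xs} → All (λ x → P x ⊎ Q x) xs →
  Σ[ ys ∈ List A ] Σ[ zs ∈ List A ]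
    ys ⊆ xs × zs ⊆ xs × All P ys × All Q zs × length xs ≡ length ys + length zs
split [] = [] , [] , [] , [] , [] , [] , refl
split (d ∷ ds) with split ds
split (inj₁ p ∷ ds) | ys , zs , s , t , ps , qs , eq =
  _ ∷ ys , zs , refl ∷ s , _ ∷ʳ t , p ∷ ps , qs , cong suc eq
split (inj₂ q ∷ ds) | ys , zs , s , t , ps , qs , eq =
  ys , _ ∷ zs , _ ∷ʳ s , refl ∷ t , ps , q ∷ qs ,
  trans (cong suc eq) (sym (+-suc (length ys) (length zs)))

AllPairs-resp-⊆ : ∀ {A : Set} {R : A → A → Set} {xs ys} → xs ⊆ ys → AllPairs R ys → AllPairs R xs
AllPairs-resp-⊆ []         []       = []
AllPairs-resp-⊆ (_ ∷ʳ s)   (_ ∷ rs) = AllPairs-resp-⊆ s rs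
AllPairs-resp-⊆ (refl ∷ s) (r ∷ rs) = All-resp-⊆ s r ∷ AllPairs-resp-⊆ s rs

-- Turns one witness per element into a list that can be counted: `distinct` rules out repetitions,
-- and each witness keeps an owner.
collect : ∀ {A B : Set} {R : A → A → Set} {G : A → B → Set} →
  (∀ {a b x y} → R a b → G a x → G b y → x ≢ y) →
  ∀ {as} → AllPairs R as → All (λ a → Σ B (G a)) as →
  Σ[ bs ∈ List B ] length bs ≡ length as × Unique bs × All (λ b → Σ[ a ∈ A ] G a b) bs
collect {A} {B} {R} {G} distinct rs gs =
  let bs , eq , bs! , back , _ = go rs gs in bs , eq , bs! , back
  where
  go : ∀ {as} → AllPairs R as → All (λ a → Σ B (G a)) as →
    Σ[ bs ∈ List B ] length bs ≡ length as × Unique bs × All (λ b → Σ[ a ∈ A ] G a b) bs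
      -- Carried along so that the witness of the head can be compared with all witnesses from the
      -- tail.
      × (∀ {a x} → G a x → All (R a) as → All (x ≢_) bs)
  go [] [] = [] , refl , [] , [] , λ _ _ → []
  go (r ∷ rs) ((x , g) ∷ gs) =
    let bs , eq , bs! , back , apart = go rs gs in
    x ∷ bs , cong suc eq , apart g r ∷ bs! , (_ , g) ∷ back ,
    λ { h (r′ ∷ rs′) → distinct r′ h g ∷ apart h rs′ }

-- Components and the number of edges they need

-- Component labels of a graph given by its list of edges, obtained by merging two labels per edge.
merge : ℕ → ℕ → ℕ → ℕ
merge α β c with c ≟ β
... | yes _ = α
... | no  _ = c

merge-target : ∀ α β → merge α β β ≡ α
merge-target α β with β ≟ β
... | yes _ = refl
... | no ¬p = contradiction refl ¬p

merge-fixed : ∀ α β → merge α β α ≡ α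
merge-fixed α β with α ≟ β
... | yes _ = refl
... | no  _ = refl

merge-hit : ∀ {α β c} → merge α β c ≡ α → c ≡ α ⊎ c ≡ β
merge-hit {β = β} {c} eq with c ≟ β
... | yes p = inj₂ p
... | no  _ = inj₁ eq

merge-miss : ∀ {α β c} → merge α β c ≢ α → merge α β c ≡ c
merge-miss {β = β} {c} ne with c ≟ β
... | yes _ = contradiction refl ne
... | no  _ = refl

component : List Arc → ℕ → ℕ
component []             v = v
component ((a , b) ∷ es) v = merge (component es a) (component es b) (component es v)

component-edge : ∀ {x y} es → (x , y) ∈ es → component es x ≡ component es y
component-edge ((a , b) ∷ es) (here refl) =
  trans (merge-fixed (component es a) (component es b))
        (sym (merge-target (component es a) (component es b)))
component-edge ((a , b) ∷ es) (there p) =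
  cong (merge (component es a) (component es b)) (component-edge es p)

_⟨_⟩∼_ : ℕ → List Arc → List ℕ → Set
v ⟨ es ⟩∼ reps = Any (λ r → component es v ≡ component es r) reps

-- Induction on the edges. If `(a , b)` meets no component named by `reps`, deleting it changes none
-- of them. Otherwise the deletion splits at most one of them, so a single further representative
-- covers the same vertices, and the deleted edge satisfies `P` and pays for it.
forest-bound : ∀ {P : Arc → Set} (P? : Decidable P) es reps {vs} → Unique vs →
  All (_⟨ es ⟩∼ reps) vs → (∀ {e} → e ∈ es → proj₁ e ⟨ es ⟩∼ reps → P e) →
  length vs ≤ length reps + length (filter P? es)
forest-bound P? [] reps vs! cov _ = ≤-trans (unique-length-≤ vs! cov) (m≤m+n _ _)
forest-bound {P} P? ((a , b) ∷ es) reps {vs} vs! cov ins = go (any? (λ r → merge α β (φ r) ≟ α) reps)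
  where
  φ = component es
  α = φ a
  β = φ b
  separate : ∀ {c d} → merge α β d ≢ α → merge α β c ≡ merge α β d → c ≡ d
  separate ne eq = trans (sym (merge-miss (λ h → ne (trans (sym eq) h)))) (trans eq (merge-miss ne))
  -- The representative s names whichever of the two merged components r₀ does not lie in.
  extend : ∀ {r₀} s → r₀ ∈ reps → merge α β (φ r₀) ≡ α → merge α β (φ s) ≡ α →
    (∀ {c} → merge α β c ≡ α → c ≡ φ r₀ ⊎ c ≡ φ s) →
    length vs ≤ length reps + length (filter P? ((a , b) ∷ es))
  extend {r₀} s r₀∈ h₀ h only = begin
    length vs                                        ≤⟨ forest-bound P? es (s ∷ reps) vs! (All.map cover cov) inside ⟩
    suc (length reps + length (filter P? es))        ≡⟨ +-suc (length reps) _ ⟨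
    length reps + suc (length (filter P? es))        ≡⟨ cong (λ l → length reps + length l) (filter-accept P? Pab) ⟨
    length reps + length (filter P? ((a , b) ∷ es))  ∎
    where
    open ≤-Reasoning
    Pab : P (a , b)
    Pab = ins (here refl) (lose r₀∈ (trans (merge-fixed α β) (sym h₀)))
    cover : ∀ {v} → v ⟨ (a , b) ∷ es ⟩∼ reps → v ⟨ es ⟩∼ (s ∷ reps)
    cover {v} c with find c | merge α β (φ v) ≟ α
    ... | r , r∈ , eq | yes m = [ (λ p → there (lose r₀∈ p)) , here ]′ (only m)
    ... | r , r∈ , eq | no ¬m = there (lose r∈ (separate (¬m ∘ trans eq) eq))
    inside : ∀ {e} → e ∈ es → proj₁ e ⟨ es ⟩∼ (s ∷ reps) → P e
    inside e∈ (here eq) = ins (there e∈) (lose r₀∈ (trans (cong (merge α β) eq) (trans h (sym h₀))))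
    inside e∈ (there c) = ins (there e∈) (Any.map (cong (merge α β)) c)
  go : Dec (Any (λ r → merge α β (φ r) ≡ α) reps) →
    length vs ≤ length reps + length (filter P? ((a , b) ∷ es))
  go (no ¬hit) = ≤-trans
    (forest-bound P? es reps vs!
      (All.map (λ c → let r , r∈ , eq = find c in lose r∈ (separate (¬hit ∘ lose r∈) eq)) cov)
      (λ e∈ c → ins (there e∈) (Any.map (cong (merge α β)) c)))
    (+-monoʳ-≤ (length reps) grow)
    where
    grow : length (filter P? es) ≤ length (filter P? ((a , b) ∷ es))
    grow with P? (a , b)
    ... | yes _ = n≤1+n _
    ... | no  _ = ≤-refl
  go (yes hit) with find hit
  ... | r₀ , r₀∈ , h₀ with merge-hit h₀
  ...   | inj₁ p = extend b r₀∈ h₀ (merge-target α β) (λ m → Sum.map₁ (λ q → trans q (sym p)) (merge-hit m))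
  ...   | inj₂ p = extend a r₀∈ h₀ (merge-fixed α β)
                     (λ m → Sum.swap (Sum.map₂ (λ q → trans q (sym p)) (merge-hit m)))

-- Walks and increasing walks

data Walk (R : ℕ → ℕ → Set) : ℕ → ℕ → ℕ → Set where
  []  : ∀ {x} → Walk R 0 x x
  _∷_ : ∀ {l x y z} → R x y → Walk R l y z → Walk R (suc l) x z

_++ʷ_ : ∀ {R l m x y z} → Walk R l x y → Walk R m y z → Walk R (l + m) x z
[]       ++ʷ w = w
(r ∷ v) ++ʷ w = r ∷ (v ++ʷ w)

map-walk : ∀ {R S : ℕ → ℕ → Set} → (∀ {x y} → R x y → S x y) → ∀ {l x y} → Walk R l x y → Walk S l x y
map-walk f []       = []
map-walk f (r ∷ w) = f r ∷ map-walk f w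

take-walk : ∀ {R l x z} m → m ≤ l → Walk R l x z → ∃[ y ] Walk R m x y
take-walk zero    _         w       = _ , []
take-walk (suc m) (s≤s m≤l) (r ∷ w) = let y , v = take-walk m m≤l w in y , r ∷ v

first-step : ∀ {R l x z} → Walk R l x z → l ≡ 0 ⊎ ∃[ y ] R x y
first-step []      = inj₁ refl
first-step (r ∷ _) = inj₂ (_ , r)

last-step : ∀ {R l x z} → Walk R l x z → l ≡ 0 ⊎ ∃[ y ] R y z
last-step []      = inj₁ refl
last-step (r ∷ w) with last-step w | w
... | inj₂ s | _  = inj₂ s
... | inj₁ _ | [] = inj₂ (_ , r)

vertices : ∀ {R l x y} → Walk R l x y → List ℕ
vertices {x = x} []      = x ∷ []
vertices {x = x} (_ ∷ w) = x ∷ vertices w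

steps : ∀ {R l x y} → Walk R l x y → List Arc
steps []                    = []
steps (_∷_ {x = x} {y} _ w) = (x , y) ∷ steps w

length-vertices : ∀ {R l x y} (w : Walk R l x y) → length (vertices w) ≡ suc l
length-vertices []      = refl
length-vertices (_ ∷ w) = cong suc (length-vertices w)

length-steps : ∀ {R l x y} (w : Walk R l x y) → length (steps w) ≡ l
length-steps []      = refl
length-steps (_ ∷ w) = cong suc (length-steps w)

prefix-to : ∀ {R l x y v} (w : Walk R l x y) → v ∈ vertices w → ∃[ m ] Walk R m x v
prefix-to []      (here refl) = 0 , []
prefix-to (r ∷ w) (here refl) = 0 , []
prefix-to (r ∷ w) (there v∈)  = let m , p = prefix-to w v∈ in suc m , r ∷ p

suffix-from : ∀ {R l x y v} (w : Walk R l x y) → v ∈ vertices w → ∃[ m ] Walk R m v y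
suffix-from []      (here refl) = 0 , []
suffix-from (r ∷ w) (here refl) = _ , r ∷ w
suffix-from (r ∷ w) (there v∈)  = suffix-from w v∈

module _ {R : ℕ → ℕ → Set} (R⇒< : ∀ {x y} → R x y → x < y) where

  walk-≤ : ∀ {l x y} → Walk R l x y → x ≤ y
  walk-≤ []      = ≤-refl
  walk-≤ (r ∷ w) = <⇒≤ (<-≤-trans (R⇒< r) (walk-≤ w))

  vertices-bounds : ∀ {l x y} (w : Walk R l x y) → All (λ v → x ≤ v × v ≤ y) (vertices w)
  vertices-bounds []      = (≤-refl , ≤-refl) ∷ []
  vertices-bounds (r ∷ w) = (≤-refl , walk-≤ (r ∷ w)) ∷
    All.map (λ { (p , q) → ≤-trans (<⇒≤ (R⇒< r)) p , q }) (vertices-bounds w)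

  vertices-unique : ∀ {l x y} (w : Walk R l x y) → Unique (vertices w)
  vertices-unique []      = [] ∷ []
  vertices-unique (r ∷ w) =
    All.map (λ { (p , _) → <⇒≢ (<-≤-trans (R⇒< r) p) }) (vertices-bounds w) ∷ vertices-unique w

  steps-bounds : ∀ {l x y} (w : Walk R l x y) → All (λ e → x ≤ proj₁ e × proj₂ e ≤ y) (steps w)
  steps-bounds []      = []
  steps-bounds (r ∷ w) = (≤-refl , walk-≤ w) ∷
    All.map (λ { (p , q) → ≤-trans (<⇒≤ (R⇒< r)) p , q }) (steps-bounds w)

  steps-unique : ∀ {l x y} (w : Walk R l x y) → Unique (steps w)
  steps-unique []      = []
  steps-unique (r ∷ w) =
    All.map (λ { (p , _) → <⇒≢ (<-≤-trans (R⇒< r) p) ∘ cong proj₁ }) (steps-bounds w) ∷ steps-unique w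

  -- Steps increase, so an increasing walk visits its vertices in their order as numbers.
  between : ∀ {l x y u v} (w : Walk R l x y) → u ∈ vertices w → v ∈ vertices w → u ≤ v → ∃[ m ] Walk R m u v
  between []      (here refl) (here refl) _   = 0 , []
  between (r ∷ w) (here refl) v∈          _   = prefix-to (r ∷ w) v∈
  between (r ∷ w) (there u∈)  (there v∈)  u≤v = between w u∈ v∈ u≤v
  between (r ∷ w) (there u∈)  (here refl) u≤v =
    contradiction u≤v (<⇒≱ (<-≤-trans (R⇒< r) (proj₁ (All.lookup (vertices-bounds w) u∈))))

-- Bridges and the extremal bound on the number of edges

Serial : Arc → Arc → Set
Serial p q = proj₂ p < proj₁ q

Path-in : List Arc → ℕ → ℕ → ℕ → Set
Path-in E = Walk (λ x y → (x , y) ∈ E)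

-- Adding the edge p to E would complete a path with N + 1 edges through p.
record Bridge (E : List Arc) (N : ℕ) (p : Arc) : Set where
  field
    {a b s t} : ℕ
    total : a + b ≡ N
    inw   : Path-in E a s (proj₁ p)
    out   : Path-in E b (proj₂ p) t
    ord   : proj₁ p < proj₂ p
open Bridge

-- The extremal statement behind the lower bound: a graph without increasing paths of more than N edges
-- that has serial bridges p₀, ps cannot have fewer than N + length ps - 1 edges.
module Extremal (E : List Arc) (E! : Unique E) (E< : ∀ {x y} → (x , y) ∈ E → x < y)
                (N : ℕ) (short : ∀ {l x y} → Path-in E l x y → l ≤ N) where

  private
    Path′ : ℕ → ℕ → ℕ → Set
    Path′ = Path-in E

    Bridge′ : Arc → Set
    Bridge′ = Bridge E N

  steps⊆ : ∀ {l x y} (w : Path′ l x y) → All (_∈ E) (steps w)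
  steps⊆ []      = []
  steps⊆ (r ∷ w) = r ∷ steps⊆ w

  label : ℕ → ℕ
  label = component E

  vertices-label : ∀ {l x y} (w : Path′ l x y) → All (λ v → label v ≡ label x) (vertices w)
  vertices-label []      = refl ∷ []
  vertices-label (r ∷ w) = refl ∷ All.map (λ q → trans q (sym (component-edge E r))) (vertices-label w)

  steps-label : ∀ {l x y} (w : Path′ l x y) → All (λ e → label (proj₁ e) ≡ label x) (steps w)
  steps-label []      = []
  steps-label (r ∷ w) = refl ∷ All.map (λ q → trans q (sym (component-edge E r))) (steps-label w)

  end-label : ∀ {l x y} → Path′ l x y → label x ≡ label y
  end-label []      = refl
  end-label (r ∷ w) = trans (component-edge E r) (end-label w)

  -- Such a walk would fit between `inw B` and `out B` and make a path with more than `N` edges.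
  disconnected : ∀ {p l} → Bridge′ p → Path′ (suc l) (proj₁ p) (proj₂ p) → ⊥
  disconnected {p} {l} B w = <-irrefl refl (begin-strict
    N                         ≡⟨ total B ⟨
    a B + b B                 <⟨ +-monoʳ-< (a B) (s≤s (m≤n+m (b B) l)) ⟩
    a B + (suc l + b B)       ≤⟨ short (inw B ++ʷ (w ++ʷ out B)) ⟩
    N                         ∎)
    where open ≤-Reasoning

  bridge-steps : ∀ {p} → Bridge′ p → List Arc
  bridge-steps B = steps (inw B) ++ steps (out B)

  length-bridge-steps : ∀ {p} (B : Bridge′ p) → length (bridge-steps B) ≡ N
  length-bridge-steps B = trans (length-++ (steps (inw B)))
    (trans (cong₂ _+_ (length-steps (inw B)) (length-steps (out B))) (total B))

  bridge-steps⊆ : ∀ {p} (B : Bridge′ p) → All (_∈ E) (bridge-steps B)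
  bridge-steps⊆ B = All.++⁺ (steps⊆ (inw B)) (steps⊆ (out B))

  ordered-disjoint : ∀ {l m x y x′ y′} (v : Path′ l x y) (w : Path′ m x′ y′) → y ≤ x′ →
    ∀ {e} → e ∈ steps v → e ∉ steps w
  ordered-disjoint v w y≤x′ p q = <-irrefl refl (begin-strict
    _ <⟨ E< (All.lookup (steps⊆ v) p) ⟩
    _ ≤⟨ proj₂ (All.lookup (steps-bounds E< v) p) ⟩
    _ ≤⟨ y≤x′ ⟩
    _ ≤⟨ proj₁ (All.lookup (steps-bounds E< w) q) ⟩
    _ ∎)
    where open ≤-Reasoning

  bridge-steps-unique : ∀ {p} (B : Bridge′ p) → Unique (bridge-steps B)
  bridge-steps-unique B = Unique.++⁺ (steps-unique E< (inw B)) (steps-unique E< (out B))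
    (λ { (p , q) → ordered-disjoint (inw B) (out B) (<⇒≤ (ord B)) p q })

  module _ {p₀ : Arc} {ps : List Arc} (B₀ : Bridge′ p₀) (after : All (Serial p₀) ps) (serial : AllPairs Serial ps)
           (Bs : All Bridge′ ps) (few : 3 * length ps ≤ N + 2) (sparse : length E + 2 ≤ N + length ps) where

    private
      -- The paths `inw B₀` and `out B₀` lie in the components of these two vertices. The two
      -- components may coincide; `forest-bound` allows for that.
      roots : List ℕ
      roots = proj₁ p₀ ∷ proj₂ p₀ ∷ []

      Inside : ℕ → Set
      Inside v = v ⟨ E ⟩∼ roots

      inside? : Decidable Inside
      inside? v = any? (λ r → label v ≟ label r) roots

      X : List ℕ
      X = vertices (inw B₀) ++ vertices (out B₀)

      -- Three times `sparse` combined with `few` gives `3 * length E + 6 ≤ 4 * N + 2`. The bound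
      -- `few` enters only through this estimate.
      sparse′ : ¬ N + N + (N + N) ≤ length E + (length E + length E)
      sparse′ le = <-irrefl refl (begin-strict
        N + N + (N + N) + 2                          <⟨ +-monoʳ-< (N + N + (N + N)) (s≤s (s≤s (s≤s z≤n))) ⟩
        N + N + (N + N) + 6                          ≤⟨ +-monoˡ-≤ 6 le ⟩
        length E + (length E + length E) + 6         ≡⟨ lhs (length E) ⟩
        3 * (length E + 2)                           ≤⟨ *-monoʳ-≤ 3 sparse ⟩
        3 * (N + length ps)                          ≡⟨ *-distribˡ-+ 3 N (length ps) ⟩
        3 * N + 3 * length ps                        ≤⟨ +-monoʳ-≤ (3 * N) few ⟩
        3 * N + (N + 2)                              ≡⟨ rhs N ⟩
        N + N + (N + N) + 2                          ∎)
        where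
        open ≤-Reasoning
        lhs : ∀ e → e + (e + e) + 6 ≡ 3 * (e + 2)
        lhs = solve-∀
        rhs : ∀ e → 3 * e + (e + 2) ≡ e + e + (e + e) + 2
        rhs = solve-∀

      X-inside : All Inside X
      X-inside = All.++⁺
        (All.map (λ q → here (trans q (end-label (inw B₀)))) (vertices-label (inw B₀)))
        (All.map (λ q → there (here q)) (vertices-label (out B₀)))

      steps₀-inside : All (Inside ∘ proj₁) (bridge-steps B₀)
      steps₀-inside = All.++⁺
        (All.map (λ q → here (trans q (end-label (inw B₀)))) (steps-label (inw B₀)))
        (All.map (λ q → there (here q)) (steps-label (out B₀)))

      respects : ∀ {v w} → label v ≡ label w → Inside v → Inside w
      respects eq = Any.map (trans (sym eq))

      outside-disjoint : ∀ {l x y} (w : Path′ l x y) → ¬ Inside x →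
        ∀ {e} → e ∈ steps w → e ∉ bridge-steps B₀
      outside-disjoint w ¬in p q = ¬in (respects (All.lookup (steps-label w) p) (All.lookup steps₀-inside q))

      -- The walk stays in a component that `inw B₀` and `out B₀` avoid, so its steps come on top of
      -- the `N` steps of `B₀`.
      outside-short : ∀ {l x y} → Path′ l x y → ¬ Inside x → l + N ≤ length E
      outside-short w ¬in = subst₂ (λ i j → i + j ≤ length E) (length-steps w) (length-bridge-steps B₀)
        (disjoint-length-≤ (steps-unique E< w) (bridge-steps-unique B₀) (outside-disjoint w ¬in)
          (steps⊆ w) (bridge-steps⊆ B₀))

      -- What a bridged pair p contributes: a vertex of the inside that is not in X, or an edge of the
      -- outside, or nothing.
      NewVertex : Arc → ℕ → Set
      NewVertex p v = (v ≡ proj₁ p ⊎ v ≡ proj₂ p) × proj₁ p < proj₂ p × Inside v × v ∉ X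

      OutsideArc : Arc → Arc → Set
      OutsideArc p e = e ∈ E × ¬ Inside (proj₁ e) × Σ[ B ∈ Bridge′ p ]
        ((proj₁ e ≡ proj₂ p × b B + N ≤ length E) ⊎ (proj₂ e ≡ proj₁ p × a B + N ≤ length E))

      Last : Arc → Set
      Last p = proj₁ p ≡ t B₀ × proj₁ p < proj₂ p

      beyond : ∀ {v} → proj₂ p₀ < v → v ∈ X → v ∈ vertices (out B₀)
      beyond v₀<v v∈ with ∈-++⁻ (vertices (inw B₀)) v∈
      ... | inj₁ q = contradiction (proj₂ (All.lookup (vertices-bounds E< (inw B₀)) q))
                       (<⇒≱ (<-trans (ord B₀) v₀<v))
      ... | inj₂ q = q

      -- An end that is inside but not in `X` is a new vertex. Otherwise each end is in `X` or
      -- outside. If just one end is outside, the path of `B` at that end supplies an outside edge,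
      -- unless this path is empty.
      classify : ∀ {p} → Serial p₀ p → Bridge′ p →
        Σ ℕ (NewVertex p) ⊎ (Σ Arc (OutsideArc p) ⊎ Last p)
      classify {u , v} v₀<u B = go (inside? u) (inside? v) (u ∈? X) (v ∈? X)
        where
        v₀<v : proj₂ p₀ < v
        v₀<v = <-trans v₀<u (ord B)

        go : Dec (Inside u) → Dec (Inside v) → Dec (u ∈ X) → Dec (v ∈ X) →
          Σ ℕ (NewVertex (u , v)) ⊎ (Σ Arc (OutsideArc (u , v)) ⊎ Last (u , v))
        go (yes u-in) _ (no u∉) _ = inj₁ (u , inj₁ refl , ord B , u-in , u∉)
        go _ (yes v-in) _ (no v∉) = inj₁ (v , inj₂ refl , ord B , v-in , v∉)
        -- Both ends lie on `out B₀`, and the part of it between them contradicts `disconnected`.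
        go _ _ (yes u∈) (yes v∈)
          with between E< (out B₀) (beyond v₀<u u∈) (beyond v₀<v v∈) (<⇒≤ (ord B))
        ... | zero  , [] = contradiction (ord B) (<-irrefl refl)
        ... | suc _ , w  = ⊥-elim (disconnected B w)
        go _ (no v-out) (yes u∈) _ with first-step (out B)
        ... | inj₂ (y , e∈) =
          inj₂ (inj₁ ((v , y) , e∈ , v-out , B , inj₁ (refl , outside-short (out B) v-out)))
        -- Now `inw B` has all `N` edges and cannot be prolonged along `out B₀`, so `u` is the last
        -- vertex there. This is the exception `Last`.
        ... | inj₁ b≡0 with suffix-from (out B₀) (beyond v₀<u u∈)
        ...   | zero  , [] = inj₂ (inj₂ (refl , ord B))
        ...   | suc m , w  = contradiction (short (inw B ++ʷ w)) (<⇒≱ (begin-strict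
          N             ≡⟨ total B ⟨
          a B + b B     ≡⟨ cong (a B +_) b≡0 ⟩
          a B + 0       <⟨ +-monoʳ-< (a B) (s≤s z≤n) ⟩
          a B + suc m   ∎))
          where open ≤-Reasoning
        go (no u-out) _ _ (yes v∈) with last-step (inw B)
        ... | inj₂ (y , e∈) = inj₂ (inj₁ ((y , u) , e∈ , u-out ∘ respects (component-edge E e∈) , B ,
          inj₂ (refl , outside-short (inw B) (u-out ∘ respects (end-label (inw B))))))
        -- No exception on this side: `v` lies beyond `proj₂ p₀`, so the part of `out B₀` leading to
        -- it is nonempty, and it prolongs the `N` edges of `out B`.
        ... | inj₁ a≡0 with prefix-to (out B₀) (beyond v₀<v v∈)
        ...   | zero  , [] = contradiction v₀<v (<-irrefl refl)
        ...   | suc m , w  = contradiction (short (w ++ʷ out B)) (<⇒≱ (begin-strict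
          N             ≡⟨ total B ⟨
          a B + b B     ≡⟨ cong (_+ b B) a≡0 ⟩
          b B           <⟨ s≤s (m≤n+m (b B) m) ⟩
          suc m + b B   ∎))
          where open ≤-Reasoning
        -- The `N` steps of `B` and the `N` steps of `B₀` lie in different components, so
        -- `2 * N ≤ length E`.
        go (no u-out) (no v-out) _ _ = contradiction (+-mono-≤ twice (≤-trans twice (m≤m+n _ _))) sparse′
          where
          disj : ∀ {e} → e ∈ bridge-steps B → e ∉ bridge-steps B₀
          disj e∈ with ∈-++⁻ (steps (inw B)) e∈
          ... | inj₁ q = outside-disjoint (inw B) (u-out ∘ respects (end-label (inw B))) q
          ... | inj₂ q = outside-disjoint (out B) v-out q
          twice : N + N ≤ length E
          twice = subst₂ (λ i j → i + j ≤ length E) (length-bridge-steps B) (length-bridge-steps B₀)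
            (disjoint-length-≤ (bridge-steps-unique B) (bridge-steps-unique B₀) disj
              (bridge-steps⊆ B) (bridge-steps⊆ B₀))

      newVertex-distinct : ∀ {p q v w} → Serial p q → NewVertex p v → NewVertex q w → v ≢ w
      newVertex-distinct {p} {q} p<q (v≡ , up , _) (w≡ , uq , _) refl = <-irrefl refl (begin-strict
        _       ≤⟨ [ (λ { refl → <⇒≤ up }) , (λ { refl → ≤-refl }) ]′ v≡ ⟩
        proj₂ p <⟨ p<q ⟩
        proj₁ q ≤⟨ [ (λ { refl → ≤-refl }) , (λ { refl → <⇒≤ uq }) ]′ w≡ ⟩
        _       ∎)
        where open ≤-Reasoning

      -- Edges on the same side of `p` and `q` differ at an endpoint, and an edge from the right of
      -- `q` to the left of `p` would decrease. In the last case, an edge after `p` and one before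
      -- `q`, the two length bounds and the disjointness of `inw B` and `out C` add up to
      -- `4 * N ≤ 3 * length E`.
      outsideArc-distinct : ∀ {p q e f} → Serial p q → OutsideArc p e → OutsideArc q f → e ≢ f
      outsideArc-distinct p<q (_ , _ , _ , inj₁ (refl , _)) (_ , _ , C , inj₁ (eq , _)) refl =
        <-irrefl eq (<-trans p<q (ord C))
      outsideArc-distinct p<q (_ , _ , B , inj₂ (refl , _)) (_ , _ , _ , inj₂ (eq , _)) refl =
        <-irrefl eq (<-trans (ord B) p<q)
      outsideArc-distinct p<q (e∈ , _ , B , inj₂ (refl , _)) (_ , _ , C , inj₁ (refl , _)) refl =
        <-asym (E< e∈) (<-trans (ord B) (<-trans p<q (ord C)))
      outsideArc-distinct {p} {q} p<q (_ , _ , B , inj₁ (_ , long)) (_ , _ , C , inj₂ (_ , long′)) _ =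
        sparse′ (begin
          N + N + (N + N)                            ≡⟨ cong₂ (λ i j → i + j + (N + N)) (sym (total B)) (sym (total C)) ⟩
          a B + b B + (a C + b C) + (N + N)          ≡⟨ regroup (a B) (b B) (a C) (b C) N ⟩
          a B + b C + (b B + N + (a C + N))          ≤⟨ +-mono-≤ apart (+-mono-≤ long long′) ⟩
          length E + (length E + length E)           ∎)
        where
        open ≤-Reasoning
        regroup : ∀ x y z w n → x + y + (z + w) + (n + n) ≡ x + w + (y + n + (z + n))
        regroup = solve-∀
        apart : a B + b C ≤ length E
        apart = subst₂ (λ i j → i + j ≤ length E) (length-steps (inw B)) (length-steps (out C))
          (disjoint-length-≤ (steps-unique E< (inw B)) (steps-unique E< (out C))
            (ordered-disjoint (inw B) (out C) (<⇒≤ (<-trans (ord B) (<-trans p<q (ord C)))))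
            (steps⊆ (inw B)) (steps⊆ (out C)))

      last-once : ∀ {qs} → All Last qs → AllPairs Serial qs → length qs ≤ 1
      last-once [] _ = z≤n
      last-once (_ ∷ []) _ = s≤s z≤n
      last-once ((refl , u<v) ∷ (eq , _) ∷ _) ((p<q ∷ _) ∷ _) =
        contradiction (<-trans u<v p<q) (<-irrefl (sym eq))

    too-sparse : ⊥
    too-sparse
      with split (All.zipWith (λ { (s , B) → classify s B }) (after , Bs))
    ... | ps₁ , ps₂₃ , sub₁ , sub₂₃ , new , rest , len
      with split rest
    ... | ps₂ , ps₃ , sub₂ , sub₃ , edge , lasts , len′
      with collect newVertex-distinct (AllPairs-resp-⊆ sub₁ serial) new
         | collect outsideArc-distinct (AllPairs-resp-⊆ sub₂ (AllPairs-resp-⊆ sub₂₃ serial)) edge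
    ... | vs , vs-len , vs! , vs-new | es , es-len , es! , es-out =
      <-irrefl refl (begin-strict
        N + length ps                                  ≡⟨ cong (N +_) contributions ⟩
        N + (length vs + (length es + length ps₃))     ≤⟨ +-monoʳ-≤ N (+-monoʳ-≤ (length vs) (+-monoʳ-≤ (length es) once)) ⟩
        N + (length vs + (length es + 1))              ≡⟨ regroup N (length vs) (length es) ⟩
        N + length vs + length es + 1                  ≤⟨ +-monoˡ-≤ 1 (+-monoˡ-≤ (length es) vertex-count) ⟩
        length inner + length es + 1                   ≤⟨ +-monoˡ-≤ 1 edge-count ⟩
        length E + 1                                   <⟨ +-monoʳ-< (length E) (s≤s (s≤s z≤n)) ⟩
        length E + 2                                   ≤⟨ sparse ⟩
        N + length ps                                  ∎)
      where
      open ≤-Reasoning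
      regroup : ∀ x y z → x + (y + (z + 1)) ≡ x + y + z + 1
      regroup = solve-∀
      contributions : length ps ≡ length vs + (length es + length ps₃)
      contributions = trans len (cong₂ _+_ (sym vs-len) (trans len′ (cong (_+ length ps₃) (sym es-len))))
      once : length ps₃ ≤ 1
      once = last-once lasts (AllPairs-resp-⊆ sub₃ (AllPairs-resp-⊆ sub₂₃ serial))
      inner : List Arc
      inner = filter (inside? ∘ proj₁) E
      X! : Unique X
      X! = Unique.++⁺ (vertices-unique E< (inw B₀)) (vertices-unique E< (out B₀))
        λ { (p , q) → <⇒≱ (ord B₀) (≤-trans (proj₁ (All.lookup (vertices-bounds E< (out B₀)) q))
                                            (proj₂ (All.lookup (vertices-bounds E< (inw B₀)) p))) }
      length-X : length X ≡ 2 + N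
      length-X = trans (length-++ (vertices (inw B₀)))
        (trans (cong₂ _+_ (length-vertices (inw B₀)) (length-vertices (out B₀)))
        (trans (cong suc (+-suc (a B₀) (b B₀))) (cong (2 +_) (total B₀))))
      vertex-count : N + length vs ≤ length inner
      -- There are `2 + N + length vs` distinct vertices in the components of the two roots; the `2`
      -- cancels against the number of roots.
      vertex-count = +-cancelˡ-≤ 2 _ _ (subst (_≤ 2 + length inner)
        (trans (length-++ X) (cong (_+ length vs) length-X))
        (forest-bound (inside? ∘ proj₁) E roots
          (Unique.++⁺ X! vs! λ { (p , q) → proj₂ (proj₂ (proj₂ (proj₂ (All.lookup vs-new q)))) p })
          (All.++⁺ X-inside (All.map (λ { (_ , _ , _ , i , _) → i }) vs-new))
          (λ _ i → i)))
      edge-count : length inner + length es ≤ length E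
      edge-count = disjoint-length-≤ (Unique.filter⁺ (inside? ∘ proj₁) E!) es!
        (λ e∈ q → proj₁ (proj₂ (proj₂ (All.lookup es-out q))) (proj₂ (∈-filter⁻ (inside? ∘ proj₁) {xs = E} e∈)))
        (All.tabulate (λ e∈ → proj₁ (∈-filter⁻ (inside? ∘ proj₁) e∈)))
        (All.map (λ { (_ , e∈ , _) → e∈ }) es-out)

-- Colour classes of a position and the copies found in them

blues reds : List ColEdge → List Arc
blues []                   = []
blues ((i , j , blue) ∷ h) = (i , j) ∷ blues h
blues ((i , j , red)  ∷ h) = blues h
reds []                    = []
reds ((i , j , blue) ∷ h)  = reds h
reds ((i , j , red)  ∷ h)  = (i , j) ∷ reds h

length-colours : ∀ h → length h ≡ length (blues h) + length (reds h)
length-colours []                   = refl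
length-colours ((_ , _ , blue) ∷ h) = cong suc (length-colours h)
length-colours ((_ , _ , red)  ∷ h) = trans (cong suc (length-colours h)) (sym (+-suc (length (blues h)) _))

blues⁺ : ∀ {i j} h → (i , j , blue) ∈ h → (i , j) ∈ blues h
blues⁺ (_ ∷ _)                  (here refl) = here refl
blues⁺ ((_ , _ , blue) ∷ h) (there p)   = there (blues⁺ h p)
blues⁺ ((_ , _ , red)  ∷ h) (there p)   = blues⁺ h p

blues⁻ : ∀ {i j} h → (i , j) ∈ blues h → (i , j , blue) ∈ h
blues⁻ ((_ , _ , blue) ∷ h) (here refl) = here refl
blues⁻ ((_ , _ , blue) ∷ h) (there p)   = there (blues⁻ h p)
blues⁻ ((_ , _ , red)  ∷ h) p           = there (blues⁻ h p)

reds⁺ : ∀ {i j} h → (i , j , red) ∈ h → (i , j) ∈ reds h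
reds⁺ (_ ∷ _)              (here refl) = here refl
reds⁺ ((_ , _ , blue) ∷ h) (there p)   = reds⁺ h p
reds⁺ ((_ , _ , red)  ∷ h) (there p)   = there (reds⁺ h p)

SerialMatching : ℕ → List Arc → Set
SerialMatching k es = Σ[ ps ∈ List Arc ] length ps ≡ k × AllPairs Serial ps × All (_∈ es) ps

matching-copy⁻ : ∀ k {h} → HasCopy (Matching k) red h → SerialMatching k (reds h)
matching-copy⁻ k {h} (f , mono , edge) =
  tabulate pair , length-tabulate pair , AllPairs.tabulate⁺-< serial ,
  All.tabulate⁺ (λ i → reds⁺ h (edge (left i) (right i) (left<right i) (toℕ i , toℕ-left i , toℕ-right i)))
  where
  lt : ∀ (i : Fin k) → suc (2 * toℕ i) < 2 * k
  lt i = ≤-trans (≤-reflexive (sym (*-suc 2 (toℕ i)))) (*-monoʳ-≤ 2 (toℕ<n i))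
  left right : Fin k → Fin (2 * k)
  left  i = fromℕ< (<-trans (n<1+n _) (lt i))
  right i = fromℕ< (lt i)
  toℕ-left : ∀ i → toℕ (left i) ≡ 2 * toℕ i
  toℕ-left i = toℕ-fromℕ< _
  toℕ-right : ∀ i → toℕ (right i) ≡ suc (2 * toℕ i)
  toℕ-right i = toℕ-fromℕ< _
  left<right : ∀ i → toℕ (left i) < toℕ (right i)
  left<right i = subst₂ _<_ (sym (toℕ-left i)) (sym (toℕ-right i)) (n<1+n _)
  pair : Fin k → Arc
  pair i = f (left i) , f (right i)
  serial : ∀ {i j} → i Fin.< j → Serial (pair i) (pair j)
  serial {i} {j} i<j = mono (right i) (left j) (subst₂ _<_ (sym (toℕ-right i)) (sym (toℕ-left j))
    (≤-trans (≤-reflexive (sym (*-suc 2 (toℕ i)))) (*-monoʳ-≤ 2 i<j)))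

trace : ∀ {R : ℕ → ℕ → Set} l (g : Fin (suc l) → ℕ) → (∀ i → R (g (Fin.inject₁ i)) (g (Fin.suc i))) →
  ∃[ y ] Walk R l (g Fin.zero) y
trace zero    g r = _ , []
trace (suc l) g r = let y , w = trace l (g ∘ Fin.suc) (r ∘ Fin.suc) in y , r Fin.zero ∷ w

path-copy⁻ : ∀ l {h} → HasCopy (Path (suc l)) blue h → ∃[ x ] ∃[ y ] Path-in (blues h) l x y
path-copy⁻ l {h} (f , mono , edge) = _ , trace l f λ i →
  blues⁺ h (edge (Fin.inject₁ i) (Fin.suc i) (s≤s (≤-reflexive (toℕ-inject₁ i)))
    (cong suc (sym (toℕ-inject₁ i))))

-- Since steps increase, a walk passes the new edge at most once and splits there; the `suc` counts
-- this edge.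
uses-edge : ∀ {E i j l x y} → (∀ {x y} → (x , y) ∈ E → x < y) → i < j → Path-in ((i , j) ∷ E) l x y →
  Path-in E l x y ⊎ ∃[ a ] ∃[ b ] (a + suc b ≡ l × Path-in E a x i × Path-in E b j y)
uses-edge E< i<j [] = inj₁ []
uses-edge E< i<j (e ∷ w) with uses-edge E< i<j w | e
... | inj₁ v                       | here refl = inj₂ (0 , _ , refl , [] , v)
... | inj₁ v                       | there e∈  = inj₁ (e∈ ∷ v)
... | inj₂ (a , b , eq , w₁ , w₂) | there e∈  = inj₂ (suc a , b , cong suc eq , e∈ ∷ w₁ , w₂)
... | inj₂ (a , b , eq , w₁ , w₂) | here refl = contradiction i<j (≤⇒≯ (walk-≤ E< w₁))

serial-unique : ∀ {ps} → All (λ p → proj₁ p < proj₂ p) ps → AllPairs Serial ps → Unique ps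
serial-unique []         []       = []
serial-unique (lt ∷ lts) (s ∷ ss) =
  All.map (λ { p<q refl → <-asym lt p<q }) s ∷ serial-unique lts ss

-- Painter's strategy and the lower bound

module Painter (N k : ℕ) (1≤k : 1 ≤ k) (long : 3 * k ∸ 3 ≤ 2 + N) where

  -- Painter's invariant. `bridged` reflects that she uses red only where blue would complete a path
  -- with `N + 1` edges; later blue edges preserve it.
  record Safe (h : List ColEdge) : Set where
    field
      ordered    : ∀ {x y} → (x , y) ∈ blues h → x < y
      unique     : Unique (blues h)
      noPath     : ∀ {x y} → ¬ Path-in (blues h) (suc N) x y
      noMatching : ¬ SerialMatching k (reds h)
      bridged    : All (Bridge (blues h) N) (reds h)
  open Safe

  add-blue : ∀ {i j h} → Safe h → i < j → (∀ c → (i , j , c) ∉ h) →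
    ¬ (∃[ x ] ∃[ y ] Path-in ((i , j) ∷ blues h) (suc N) x y) → Safe ((i , j , blue) ∷ h)
  add-blue {h = h} S i<j fresh ¬path = record
    { ordered    = λ { (here refl) → i<j ; (there p) → ordered S p }
    ; unique     = All.tabulate (λ { p refl → fresh blue (blues⁻ h p) }) ∷ unique S
    ; noPath     = λ w → ¬path (_ , _ , w)
    ; noMatching = noMatching S
    ; bridged    = All.map (λ B → record { total = total B ; ord = ord B
                                         ; inw = map-walk there (inw B) ; out = map-walk there (out B) })
                           (bridged S)
    }

  new-bridge : ∀ {i j h} → Safe h → i < j →
    (∃[ x ] ∃[ y ] Path-in ((i , j) ∷ blues h) (suc N) x y) → Bridge (blues h) N (i , j)
  new-bridge S i<j (_ , _ , w) with uses-edge (ordered S) i<j w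
  ... | inj₁ v = ⊥-elim (noPath S v)
  ... | inj₂ (a , b , eq , w₁ , w₂) =
    record { total = suc-injective (trans (sym (+-suc a b)) eq) ; inw = w₁ ; out = w₂ ; ord = i<j }

  -- Both colours would end the game, so the edge together with the red ones contains k serial bridges.
  stuck : ∀ {i j h} → Safe h → Bridge (blues h) N (i , j) → SerialMatching k ((i , j) ∷ reds h) →
    ¬ length h + 4 ≤ N + 2 * k
  stuck S B ([] , refl , _) = contradiction 1≤k λ ()
  stuck {i} {j} {h} S B (p₀ ∷ ps , refl , after ∷ serial , red₀ ∷ redₛ) le
    with All.map (All.lookup (B ∷ bridged S)) (red₀ ∷ redₛ)
  ... | B₀ ∷ Bs = Extremal.too-sparse (blues h) (unique S) (ordered S) N short B₀ after serial Bs few sparse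
    where
    K = suc (length ps)
    short : ∀ {l x y} → Path-in (blues h) l x y → l ≤ N
    short {l} w with suc N ≤? l
    ... | yes N<l = ⊥-elim (noPath S (proj₂ (take-walk (suc N) N<l w)))
    ... | no  N≮l = ≮⇒≥ N≮l
    few : 3 * length ps ≤ N + 2
    few = subst₂ _≤_ (trans (cong (_∸ 3) (*-suc 3 (length ps))) (m+n∸m≡n 3 _)) (+-comm 2 N) long
    K≤ : K ≤ suc (length (reds h))
    K≤ = unique-length-≤ {ys = (i , j) ∷ reds h}
      (serial-unique (ord B₀ ∷ All.map ord Bs) (after ∷ serial)) (red₀ ∷ redₛ)
    -- The `k` serial pairs are distinct and all but the current edge are red already. So at least
    -- `k - 1` of the turns were red, which leaves at most `N + k - 3` blue ones.
    sparse : length (blues h) + 2 ≤ N + length ps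
    sparse = +-cancelʳ-≤ (suc (length (reds h)) + 1) _ _ (begin
      length (blues h) + 2 + (suc (length (reds h)) + 1)  ≡⟨ regroup (length (blues h)) (length (reds h)) ⟩
      length (blues h) + length (reds h) + 4              ≡⟨ cong (_+ 4) (length-colours h) ⟨
      length h + 4                                        ≤⟨ le ⟩
      N + 2 * K                                           ≡⟨ regroup′ N (length ps) ⟩
      N + length ps + (K + 1)                             ≤⟨ +-monoʳ-≤ (N + length ps) (+-monoˡ-≤ 1 K≤) ⟩
      N + length ps + (suc (length (reds h)) + 1)         ∎)
      where
      open ≤-Reasoning
      regroup : ∀ x y → x + 2 + (suc y + 1) ≡ x + y + 4
      regroup = solve-∀
      regroup′ : ∀ x y → x + 2 * suc y ≡ x + y + (suc y + 1)
      regroup′ = solve-∀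

  -- With `n = 2 + N`, the inequality keeps the turns made and the `t` turns left below
  -- `n + 2 * k - 4` in total.
  survives : ∀ {t h} → Safe h → length h + t + 3 ≤ N + 2 * k →
    ¬ BuilderWins (Matching k) (Path (2 + N)) t h
  survives S le (done (inj₁ copy)) = noMatching S (matching-copy⁻ k copy)
  survives S le (done (inj₂ copy)) = let _ , _ , w = path-copy⁻ (suc N) copy in noPath S w
  -- The goal is a negation, so the two questions that decide Painter's colour may be taken as
  -- decided.
  survives {suc t} {h} S le (move i j i<j fresh next) = ¬¬-excluded-middle λ where
      (no ¬path)  → survives (add-blue S i<j fresh ¬path) le′ (next blue)
      (yes path) → ¬¬-excluded-middle λ where
        (no ¬matching) → survives (record
          { ordered = ordered S ; unique = unique S ; noPath = noPath S ; noMatching = ¬matching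
          ; bridged = new-bridge S i<j path ∷ bridged S }) le′ (next red)
        (yes matching) → stuck S (new-bridge S i<j path) matching
          (≤-trans (+-monoʳ-≤ (length h) (+-monoˡ-≤ 3 (s≤s z≤n)))
                   (≤-trans (≤-reflexive (sym (+-assoc (length h) (suc t) 3))) le))
    where
    le′ : suc (length h + t + 3) ≤ N + 2 * k
    le′ = subst (_≤ N + 2 * k) (cong (_+ 3) (+-suc (length h) t)) le

  start-safe : Safe []
  start-safe = record
    { ordered = λ () ; unique = [] ; noPath = λ { (() ∷ _) } ; bridged = []
    ; noMatching = λ { ([] , refl , _) → contradiction 1≤k λ () ; (_ ∷ _ , _ , _ , () ∷ _) } }

-- Copies assembled from Builder's edges, and the space he needs

position : List Arc → ℕ → ℕ
-- A default value; the indices in use stay below `2 * length ps`.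
position []             _             = 0
position ((u , v) ∷ ps) 0             = u
position ((u , v) ∷ ps) 1             = v
position (_ ∷ ps)       (suc (suc i)) = position ps i

private
  drop-pair : ∀ {i l} → suc (suc i) < 2 * suc l → i < 2 * l
  drop-pair {i} {l} lt = s≤s⁻¹ (s≤s⁻¹ (subst (suc (suc i) <_) (*-suc 2 l) lt))

position-above : ∀ {x ps} i → All (λ p → x < proj₁ p) ps → All (λ p → proj₁ p < proj₂ p) ps →
  i < 2 * length ps → x < position ps i
position-above 0             (x< ∷ _)  (_ ∷ _)   _  = x<
position-above 1             (x< ∷ _)  (lt ∷ _)  _  = <-trans x< lt
position-above (suc (suc i)) (_ ∷ x<s) (_ ∷ lts) i< = position-above i x<s lts (drop-pair i<)

position-mono : ∀ {ps i j} → AllPairs Serial ps → All (λ p → proj₁ p < proj₂ p) ps →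
  i < j → j < 2 * length ps → position ps i < position ps j
position-mono {_ ∷ _} {0}           {1}           _ (lt ∷ _) _ _ = lt
position-mono {_ ∷ _} {0}           {suc (suc j)} (s ∷ _) (lt ∷ lts) _ j< =
  <-trans lt (position-above j s lts (drop-pair j<))
position-mono {_ ∷ _} {1}           {suc (suc j)} (s ∷ _) (_ ∷ lts) _ j< = position-above j s lts (drop-pair j<)
position-mono {_ ∷ _} {suc (suc i)} {suc (suc j)} (_ ∷ ss) (_ ∷ lts) (s≤s (s≤s i<j)) j< =
  position-mono ss lts i<j (drop-pair j<)
position-mono {_ ∷ _} {1} {1} _ _ (s≤s ()) _

position-pair : ∀ {P : Arc → Set} {ps} m → All P ps → m < length ps →
  P (position ps (2 * m) , position ps (suc (2 * m)))
position-pair zero (p ∷ _) _ = p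
position-pair (suc m) (_ ∷ ps) (s≤s m<) rewrite +-suc m (m + 0) = position-pair m ps m<

Red : List ColEdge → Arc → Set
Red h (i , j) = (i , j , red) ∈ h

matching-copy⁺ : ∀ {h} ps → AllPairs Serial ps → All (λ p → proj₁ p < proj₂ p) ps → All (Red h) ps →
  HasCopy (Matching (length ps)) red h
matching-copy⁺ {h} ps serial lts rs = (λ a → position ps (toℕ a)) ,
  (λ a b a<b → position-mono serial lts a<b (toℕ<n b)) ,
  λ { a b _ (m , a≡ , b≡) → subst₂ (λ i j → (position ps i , position ps j , red) ∈ h) (sym a≡) (sym b≡)
        (position-pair {P = Red h} m rs (*-cancelˡ-< 2 m (length ps) (subst (_< 2 * length ps) a≡ (toℕ<n a)))) }

-- No edge of h starts strictly between lo and hi, so every edge starting there is new.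
Free : ℕ → ℕ → List ColEdge → Set
Free lo hi h = ∀ {i j c} → (i , j , c) ∈ h → lo < i → i < hi → ⊥

free-∷ : ∀ {lo hi h i j c} → Free lo hi h → i ≤ lo ⊎ hi ≤ i → Free lo hi ((i , j , c) ∷ h)
free-∷ fr (inj₁ le) (here refl) lo<i _    = <⇒≱ lo<i le
free-∷ fr (inj₂ le) (here refl) _    i<hi = <⇒≱ i<hi le
free-∷ fr _         (there p)             = fr p

free-⊆ : ∀ {lo hi lo′ hi′ h} → lo ≤ lo′ → hi′ ≤ hi → Free lo hi h → Free lo′ hi′ h
free-⊆ lo≤ hi≤ fr p lo<i i<hi = fr p (≤-<-trans lo≤ lo<i) (<-≤-trans i<hi hi≤)

-- A blue path with `m` vertices from `p` to `e`. Each gap along it is longer than `g` and no edge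
-- starts inside it, so that Builder can go on in the first gap once `p` is dropped.
data Spine (g : ℕ) (h : List ColEdge) (e : ℕ) : ℕ → ℕ → Set where
  top  : Spine g h e 1 e
  step : ∀ {m p q} → p + g < q → Free p q h → (p , q , blue) ∈ h → Spine g h e m q → Spine g h e (suc m) p

gap-< : ∀ {g p q} → p + g < q → p < q
gap-< {g} {p} = ≤-<-trans (m≤m+n p g)

module _ {g : ℕ} {h : List ColEdge} {e : ℕ} where

  spine-≤ : ∀ {m p} → Spine g h e m p → p ≤ e
  spine-≤ top            = ≤-refl
  spine-≤ (step lt _ _ s) = <⇒≤ (<-≤-trans (gap-< lt) (spine-≤ s))

  weaken : ∀ {g′ m p i j c} → g′ ≤ g → i ≤ p ⊎ e ≤ i → Spine g h e m p → Spine g′ ((i , j , c) ∷ h) e m p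
  weaken g′≤ side top = top
  weaken {p = p} g′≤ side (step lt fr b s) =
    step (≤-<-trans (+-monoʳ-≤ p g′≤) lt)
         (free-∷ fr (Sum.map₂ (≤-trans (spine-≤ s)) side))
         (there b)
         (weaken g′≤ (Sum.map₁ (λ i≤p → ≤-trans i≤p (<⇒≤ (gap-< lt))) side) s)

  snoc : ∀ {m p e′} → e + g < e′ → Free e e′ h → (e , e′ , blue) ∈ h → Spine g h e m p → Spine g h e′ (suc m) p
  snoc lt fr b top                = step lt fr b top
  snoc lt fr b (step lt′ fr′ b′ s) = step lt′ fr′ b′ (snoc lt fr b s)

  place : ∀ {m p} → Spine g h e m p → ℕ → ℕ
  place top                    _       = e
  place (step {p = p} _ _ _ s) zero    = p
  place (step _ _ _ s)         (suc i) = place s i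

  place-step : ∀ {m p} (s : Spine g h e m p) i → suc i < m → (place s i , place s (suc i) , blue) ∈ h
  place-step (step _ _ b top)              zero    _         = b
  place-step (step _ _ b (step _ _ _ _))   zero    _         = b
  place-step (step _ _ _ s)                (suc i) (s≤s i<m) = place-step s i i<m
  place-step top _ (s≤s ())

  place-≥ : ∀ {m p} (s : Spine g h e m p) i → p ≤ place s i
  place-≥ top             _       = ≤-refl
  place-≥ (step _ _ _ _)  zero    = ≤-refl
  place-≥ (step lt _ _ s) (suc i) = <⇒≤ (<-≤-trans (gap-< lt) (place-≥ s i))

  place-mono : ∀ {m p} (s : Spine g h e m p) {i j} → i < j → j < m → place s i < place s j
  place-mono (step lt _ _ s) {zero}  {suc j} _         _         = <-≤-trans (gap-< lt) (place-≥ s j)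
  place-mono (step _ _ _ s)  {suc i} {suc j} (s≤s i<j) (s≤s j<m) = place-mono s i<j j<m
  place-mono top {_} {suc _} _ (s≤s ())

  path-copy⁺ : ∀ {m p} → Spine g h e m p → HasCopy (Path m) blue h
  path-copy⁺ {m} s = (λ a → place s (toℕ a)) , (λ a b a<b → place-mono s a<b (toℕ<n b)) ,
    λ a b _ b≡ → subst (λ i → (place s (toℕ a) , place s i , blue) ∈ h) (sym b≡)
                   (place-step s (toℕ a) (subst (_< m) b≡ (toℕ<n b)))

record Left (h : List ColEdge) (j L : ℕ) : Set where
  constructor left-reds
  field
    list   : List Arc
    count  : length list ≡ j
    serial : AllPairs Serial list
    good   : All (λ p → proj₁ p < proj₂ p × proj₂ p ≤ L × Red h p) list

add-left : ∀ {h j L q p} → Left h j L → L < q → q < p → Left ((q , p , red) ∷ h) (suc j) p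
add-left {q = q} {p} (left-reds ps refl serial good) L<q q<p = left-reds (ps ++ (q , p) ∷ [])
  (trans (length-++ ps) (+-comm _ 1))
  (AllPairs.++⁺ serial ([] ∷ []) (All.map (λ { (_ , ≤L , _) → ≤-<-trans ≤L L<q ∷ [] }) good))
  (All.++⁺ (All.map (λ { (lt , ≤L , r) → lt , ≤-trans ≤L (<⇒≤ (<-trans L<q q<p)) , there r }) good)
           ((q<p , ≤-refl , here refl) ∷ []))

keep-left : ∀ {h j L x} → Left h j L → Left (x ∷ h) j L
keep-left (left-reds ps c serial good) =
  left-reds ps c serial (All.map (λ { (lt , ≤L , r) → lt , ≤L , there r }) good)

finish-left : ∀ {h j L B y} → Left h j L → L < B → B < y → (B , y , red) ∈ h → HasCopy (Matching (suc j)) red h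
finish-left {h} {j} {B = B} {y} (left-reds ps refl serial good) L<B B<y r =
  subst (λ k → HasCopy (Matching k) red h) (trans (length-++ ps) (+-comm _ 1))
  (matching-copy⁺ (ps ++ (B , y) ∷ [])
    (AllPairs.++⁺ serial ([] ∷ []) (All.map (λ { (_ , ≤L , _) → ≤-<-trans ≤L L<B ∷ [] }) good))
    (All.++⁺ (All.map proj₁ good) (B<y ∷ []))
    (All.++⁺ (All.map (proj₂ ∘ proj₂) good) (r ∷ [])))

-- A new vertex splits a gap into two gaps for t - 1 moves.
room : ℕ → ℕ
room zero    = 0
room (suc t) = suc (room t + room t)

room-≤ : ∀ t → room t ≤ room (suc t)
room-≤ t = m≤n⇒m≤1+n (m≤m+n (room t) (room t))

-- The vertex `suc (x + room t)` is more than `room t` away from both ends of the gap, which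
-- suffices for the `t` moves that remain.
split-room : ∀ t x {y} → x + room (suc t) < y → suc (x + room t) + room t < y
split-room t x {y} = subst (_< y) (trans (+-suc x _) (cong suc (sym (+-assoc x (room t) (room t)))))

-- Builder's strategy and the upper bound

module Builder (n k : ℕ) (1<n : 1 < n) where

  Wins : ℕ → List ColEdge → Set
  Wins = BuilderWins (Matching k) (Path n)

  -- The blue path grows to the left. The edge (B , y) is red, the path stays left of B, and j serial red
  -- edges lie left of the free gap (L , p) before the path. When the edge (q , p) comes out red, it joins
  -- these j edges, and p is dropped: the path continues in the gap to the right of p.
  leftward : ∀ t {h e m p j L B y R} → Spine (room t) h e m p →
    e ≡ B ⊎ (e + room t < B × Free e B h) → p < B → (B , y , red) ∈ h → B < y →
    L + room t < p → Free L p h → Left h j L →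
    j + suc (suc R) ≡ k → m < n → n + 2 * R ≤ t + m → Wins t h
  -- In the budget `n + 2 * R ≤ t + m`, a blue edge trades a turn for a path vertex, and each of the
  -- `R` red edges that do not yet end the game may cost a turn and a vertex. With no turns left it
  -- contradicts `m < n`.
  leftward zero s end p<B r B<y lt fr ls eq m<n le =
    contradiction (≤-trans (m≤m+n n _) le) (<⇒≱ m<n)
  leftward (suc t) {h} {e} {m} {p} {j} {L} {B} {y} {R} s end p<B r B<y lt fr ls eq m<n le =
    move q p q<p (λ _ q∈ → fr q∈ L<q q<p) λ { blue → on-blue (suc m ≟ n) ; red → on-red R eq le }
    where
    g = room t
    q = suc (L + g)
    L<q : L < q
    L<q = s≤s (m≤m+n L g)
    q+g<p : q + g < p
    q+g<p = split-room t L lt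
    q<p : q < p
    q<p = ≤-<-trans (m≤m+n q g) q+g<p

    q≤e : q ≤ e
    q≤e = ≤-trans (<⇒≤ q<p) (spine-≤ s)

    End : ℕ → List ColEdge → Set
    End g h = e ≡ B ⊎ (e + g < B × Free e B h)

    later : ∀ {c} → Spine g ((q , p , c) ∷ h) e m p
    later = weaken (room-≤ t) (inj₁ (<⇒≤ q<p)) s

    later-end : ∀ {c} → End g ((q , p , c) ∷ h)
    later-end = Sum.map₂
      (λ { (lt , fr) → ≤-<-trans (+-monoʳ-≤ e (room-≤ t)) lt , free-∷ fr (inj₁ q≤e) }) end

    extended : Spine g ((q , p , blue) ∷ h) e (suc m) q
    extended = step q+g<p (free-∷ (free-⊆ (<⇒≤ L<q) ≤-refl fr) (inj₁ ≤-refl)) (here refl) later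

    on-blue : Dec (suc m ≡ n) → Wins t ((q , p , blue) ∷ h)
    on-blue (yes refl) = done (inj₂ (path-copy⁺ extended))
    on-blue (no m+1≢n) = leftward t extended later-end (<-trans q<p p<B) (there r) B<y
      (n<1+n _) (free-∷ (free-⊆ ≤-refl (<⇒≤ q<p) fr) (inj₂ ≤-refl)) (keep-left ls) eq
      (≤∧≢⇒< m<n m+1≢n) (≤-trans le (≤-reflexive (sym (+-suc t m))))

    -- For the case that dropping `p` leaves no path vertex to the left of `B`. A single fresh
    -- vertex between `p` and `B` serves as the new path, and choosing it takes no turn.
    restart : ∀ R → j + suc (suc (suc R)) ≡ k → n + 2 * R ≤ t + 1 →
      p + room (suc t) < B → Free p B h → Wins t ((q , p , red) ∷ h)
    restart R eq le lt fr = leftward t top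
      (inj₂ (split-room t p lt , free-∷ (free-⊆ (<⇒≤ p<p′) ≤-refl fr) (inj₁ (<⇒≤ (<-trans q<p p<p′)))))
      (≤-<-trans (m≤m+n _ (room t)) (split-room t p lt)) (there r) B<y (n<1+n _)
      (free-∷ (free-⊆ ≤-refl (<⇒≤ p′<B) fr) (inj₁ (<⇒≤ q<p))) (add-left ls L<q q<p)
      (trans (sym (+-suc j _)) eq) 1<n le
      where
      p<p′ : p < suc (p + g)
      p<p′ = s≤s (m≤m+n p g)
      p′<B : suc (p + g) < B
      p′<B = ≤-<-trans (m≤m+n _ g) (split-room t p lt)

    drop-first : ∀ R {l p′} → j + suc (suc (suc R)) ≡ k → n + 2 * R ≤ t + l → l < n →
      p + room (suc t) < p′ → Free p p′ h → Spine (room (suc t)) h e l p′ → p′ < B →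
      Wins t ((q , p , red) ∷ h)
    drop-first R eq le l<n lt fr s′ p′<B = leftward t
      (weaken (room-≤ t) (inj₁ (<⇒≤ (<-trans q<p p<p′))) s′)
      later-end p′<B (there r) B<y (≤-<-trans (+-monoʳ-≤ p (room-≤ t)) lt)
      (free-∷ fr (inj₁ (<⇒≤ q<p))) (add-left ls L<q q<p) (trans (sym (+-suc j _)) eq) l<n le
      where
      p<p′ = ≤-<-trans (m≤m+n p (room (suc t))) lt

    -- The turn and the path vertex lost to a red edge are the two units released by lowering `R`.
    shift : ∀ R l → n + 2 * suc R ≤ suc t + suc l → n + 2 * R ≤ t + l
    shift R l le = +-cancelˡ-≤ 2 _ _ (subst₂ _≤_ (lhs n R) (cong suc (+-suc t l)) le)
      where
      lhs : ∀ n R → n + 2 * suc R ≡ 2 + (n + 2 * R)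
      lhs = solve-∀

    on-red : ∀ R → j + suc (suc R) ≡ k → n + 2 * R ≤ suc t + m → Wins t ((q , p , red) ∷ h)
    -- The `j` edges on the left, `(q , p)` and `(B , y)` are now `k` serial red edges.
    on-red zero eq _ = done (inj₁ (subst (λ k → HasCopy (Matching k) red ((q , p , red) ∷ h))
      (trans (+-comm 2 j) eq)
      (finish-left (add-left ls L<q q<p) p<B B<y (there r))))
    on-red (suc R) eq le = after-red s end
      where
      after-red : Spine (room (suc t)) h e m p → End (room (suc t)) h → Wins t ((q , p , red) ∷ h)
      after-red top (inj₁ refl) = contradiction p<B (<-irrefl refl)
      after-red top (inj₂ (lt , fr)) =
        restart R eq (≤-trans (shift R 0 le) (+-monoʳ-≤ t z≤n)) lt fr
      after-red (step lt fr _ top) (inj₁ refl) = restart R eq (shift R 1 le) lt fr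
      after-red (step lt fr _ top) (inj₂ (lt′ , _)) =
        drop-first R eq (shift R _ le) (<-trans (n<1+n _) m<n) lt fr top (≤-<-trans (m≤m+n e _) lt′)
      after-red (step lt fr _ s′@(step lt′ _ _ s″)) end =
        drop-first R eq (shift R _ le) (<-trans (n<1+n _) m<n) lt fr s′
          (<-≤-trans (gap-< lt′) (≤-trans (spine-≤ s″) e≤B))
        where
        e≤B : e ≤ B
        e≤B = [ ≤-reflexive , (λ { (lt , _) → ≤-trans (m≤m+n e _) (<⇒≤ lt) }) ]′ end

  -- Before the first red edge the blue path grows to the right. The first red edge then bounds it on
  -- the right at no further cost, which saves one move compared with leftward play from the start.
  rightward : ∀ t {h e m p R} → Spine (room t) h e m p → room t < p → Free 0 p h →
    (∀ {i j c} → (i , j , c) ∈ h → i < e) → suc (suc R) ≡ k → m < n → n + 2 * R + 1 ≤ t + m → Wins t h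
  rightward zero s lt fr old eq m<n le =
    contradiction (≤-trans (≤-trans (m≤m+n n _) (m≤m+n _ 1)) le) (<⇒≱ m<n)
  rightward (suc t) {h} {e} {m} {p} {R} s lt fr old eq m<n le =
    move e e′ e<e′ (λ _ e∈ → <-irrefl refl (old e∈)) λ { blue → on-blue (suc m ≟ n) ; red → on-red s le }
    where
    g = room t
    e′ = suc (e + g)
    e<e′ : e < e′
    e<e′ = s≤s (m≤m+n e g)

    later : ∀ {c} → Spine g ((e , e′ , c) ∷ h) e m p
    later = weaken (room-≤ t) (inj₂ ≤-refl) s

    extended : Spine g ((e , e′ , blue) ∷ h) e′ (suc m) p
    extended = snoc (n<1+n _)
      (λ { (here refl) e<e _ → <-irrefl refl e<e ; (there i∈) e<i _ → <-asym e<i (old i∈) }) (here refl) later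

    free : ∀ {c} → Free 0 p ((e , e′ , c) ∷ h)
    free = free-∷ fr (inj₂ (spine-≤ s))

    on-blue : Dec (suc m ≡ n) → Wins t ((e , e′ , blue) ∷ h)
    on-blue (yes refl) = done (inj₂ (path-copy⁺ extended))
    on-blue (no m+1≢n) = rightward t extended (≤-<-trans (room-≤ t) lt) free
      (λ { (here refl) → e<e′ ; (there i∈) → <-trans (old i∈) e<e′ }) eq
      (≤∧≢⇒< m<n m+1≢n) (≤-trans le (≤-reflexive (sym (+-suc t m))))

    -- The first red edge costs a turn but no path vertex, which uses up the extra `1` of the
    -- budget.
    drop-1 : ∀ {m} → n + 2 * R + 1 ≤ suc t + m → n + 2 * R ≤ t + m
    drop-1 {m} le = s≤s⁻¹ (subst (_≤ suc t + m) (+-comm _ 1) le)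

    none : ∀ {h} → Left h 0 0
    none = left-reds [] refl [] []

    on-red : Spine (room (suc t)) h e m p → n + 2 * R + 1 ≤ suc t + m → Wins t ((e , e′ , red) ∷ h)
    -- The only path vertex has become `B`, and leftward play needs a path starting left of it; the
    -- fresh vertex `suc g` in the gap `(0 , p)` takes its place.
    on-red top le = leftward t {p = suc g} top
      (inj₂ (lt , free-⊆ z≤n ≤-refl free))
      (≤-<-trans (m≤m+n (suc g) g) lt) (here refl) e<e′ (n<1+n g)
      (free-⊆ ≤-refl (<⇒≤ (≤-<-trans (m≤m+n (suc g) g) lt)) free) none eq 1<n (drop-1 le)
    on-red (step lt′ _ _ s′) le = leftward t later (inj₁ refl) (<-≤-trans (gap-< lt′) (spine-≤ s′))
      (here refl) e<e′ (≤-<-trans (room-≤ t) lt) free none eq m<n (drop-1 le)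

theorem1p3 : (n k : ℕ) → 4 ≤ n → 2 ≤ k →
    OnlineRamseyAtMost (Matching k) (Path n) (n + 2 * k ∸ 4) ×
    (3 * k ∸ 3 ≤ n → OnlineRamseyIs (Matching k) (Path n) (n + 2 * k ∸ 4))
theorem1p3 (suc zero) _ (s≤s ()) _
theorem1p3 (suc (suc _)) (suc zero) _ (s≤s ())
theorem1p3 n@(suc (suc N)) k@(suc (suc R)) _ _ =
  upper , λ long → upper , λ t t<r →
    Painter.survives N k (s≤s z≤n) long (Painter.start-safe N k (s≤s z≤n) long)
    (≤-trans (subst (_≤ n + 2 * k ∸ 4 + 2) (sym (+-suc t 2)) (+-monoˡ-≤ 2 t<r)) (≤-reflexive turns+2))
  where
  turns : n + 2 * k ∸ 4 ≡ n + 2 * R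
  turns = cong (_∸ 4) (regroup n R)
    where
    regroup : ∀ n R → n + 2 * suc (suc R) ≡ 4 + (n + 2 * R)
    regroup = solve-∀
  turns+2 : n + 2 * k ∸ 4 + 2 ≡ N + 2 * k
  turns+2 = trans (cong (_+ 2) turns) (regroup N R)
    where
    regroup : ∀ N R → 2 + N + 2 * R + 2 ≡ N + 2 * suc (suc R)
    regroup = solve-∀
  upper : OnlineRamseyAtMost (Matching k) (Path n) (n + 2 * k ∸ 4)
  -- Play starts from the single vertex `suc (room (n + 2 * k ∸ 4))`, which leaves enough space on
  -- its left for all the turns.
  upper = Builder.rightward n k 1<n (n + 2 * k ∸ 4) top (n<1+n _) (λ ()) (λ ()) refl 1<n
    (+-monoˡ-≤ 1 (≤-reflexive (sym turns)))
    where
    1<n : 1 < n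
    1<n = s≤s (s≤s z≤n)
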